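{- Let $\alpha\in\mathbb Z\setminus\{ -1,0\}$ and let $(h_n)$ be the sequence with $h_0=0$, $h_1=1$, $h_2=-\alpha(\alpha+1)$, $h_3=-\alpha^3(\alpha+1)^3$, $h_4=\alpha^6(\alpha+1)^5$, and for $m\ge2$: $h_{2m+1}=h_{m+2}h_m^3-h_{m-1}h_{m+1}^3$, for $m\ge 3$: $h_{2m}=h_m\big(h_{m+2}h_{m-1}^2-h_{m-2}h_{m+1}^2\big)/h_2$. (i) If $n\equiv 1,5,7,11\pmod{12}$, then $h_n$ is a square. (ii) If $n\equiv 1,3,9,15,17\pmod{18}$, then $h_n$ is a cube.
   Context: The sequence defined is the elliptic divisibility sequence attached to the point $(0,0)$ of order $6$ on the Tate normal form curve with $b=\alpha+\alpha^2$, $c=\alpha$; its sixth term is zero. Convention: an integer $m$ is called a square if $m=\pm\beta^2$ for some nonzero integer $\beta$, and a cube if $m=\beta^3$ for some nonzero integer $\beta$. -}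

module Defs where

open import Data.Nat as ℕ using (ℕ; zero; suc; _∸_)
open import Data.Integer using (ℤ; +_; -[1+_]; +[1+_]; _+_; _-_; _*_; -_; _^_; NonZero) renaming (_/_ to _div_)
open import Data.Product using (∃; _×_)
open import Data.Sum using (_⊎_)
open import Relation.Binary.PropositionalEquality using (_≡_; _≢_)

-- Total integer division; only ever applied with divisor h₂ = -α(α+1) ≠ 0
-- (for α ∉ {-1,0}), where the division is exact.
divZ : ℤ → ℤ → ℤ
divZ a (+ zero)    = + 0
divZ a (+[1+ n ])  = a div (+[1+ n ])
divZ a (-[1+ n ])  = a div (-[1+ n ])

h₂ h₃ h₄ : ℤ → ℤ
h₂ α = - (α * (α + + 1))
h₃ α = - ((α ^ 3) * ((α + + 1) ^ 3))
h₄ α = (α ^ 6) * ((α + + 1) ^ 5)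

step : ℤ → (ℕ → ℤ) → ℕ → ℤ
step α h 0 = + 0
step α h 1 = + 1
step α h 2 = h₂ α
step α h 3 = h₃ α
step α h 4 = h₄ α
step α h n@(suc (suc (suc (suc (suc _))))) with n ℕ.% 2
... | 0 = let m = n ℕ./ 2 in
          divZ (h m * (h (m ℕ.+ 2) * h (m ∸ 1) ^ 2 - h (m ∸ 2) * h (m ℕ.+ 1) ^ 2)) (h₂ α)
... | _ = let m = n ℕ./ 2 in
          h (m ℕ.+ 2) * h m ^ 3 - h (m ∸ 1) * h (m ℕ.+ 1) ^ 3

-- Fuel-driven evaluation: all recursive indices used by `step` at n are < n,
-- so fuel n+1 suffices.
go : ℤ → ℕ → ℕ → ℤ
go α zero    n = + 0
go α (suc f) n = step α (go α f) n

hSeq : ℤ → ℕ → ℤ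
hSeq α n = go α (suc n) n

IsSquare : ℤ → Set
IsSquare m = ∃ λ β → β ≢ + 0 × (m ≡ β * β ⊎ m ≡ - (β * β))

IsCube : ℤ → Set
IsCube m = ∃ λ β → β ≢ + 0 × m ≡ β * β * β

{-# OPTIONS --safe #-}
-- With p = h₂, q = h₃ = p³ and e = -αp⁴ one has h₄ = ep, h₅ = e², h₆ = 0, and the
-- sequence is quasi-periodic: h₆₊ₙ = -e³⁺ⁿ hₙ.  Shifting the index by 6 turns each
-- recurrence into a multiple of itself, so quasi-periodicity has to be checked only
-- for six consecutive indices, where everything reduces to the single relation
-- q³ = ep⁴ - e².  A shift by 12 multiplies hₙ by the square of e⁶⁺ⁿ and a shift by
-- 18 by the cube of -e⁹⁺ⁿ, so it remains to inspect h₁, h₅, h₇, h₁₁ for squares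
-- and h₁, h₃, h₉, h₁₅, h₁₇ for cubes; these are monomials in p and e.
module Submission where

open import Defs
open import Data.Nat using (ℕ; _%_)
open import Data.Integer using (ℤ; +_; -[1+_])
open import Data.Product using (_×_)
open import Data.Sum using (_⊎_)
open import Relation.Binary.PropositionalEquality using (_≡_; _≢_)

open import Data.Nat using (zero; suc)
import Data.Nat as ℕ
import Data.Nat.DivMod as ℕ
import Data.Nat.Properties as ℕ
open import Algebra.Properties.CommutativeSemigroup ℕ.+-commutativeSemigroup using (x∙yz≈y∙xz)
open import Data.Nat.GeneralisedArithmetic using (fold)
open import Data.Integer
  using (+[1+_]; -_; _+_; _-_; _*_; _^_; ∣_∣; NonZero) renaming (_/_ to _div_; _%_ to _mod_)
open import Data.Integer.DivMod using (a≡a%n+[a/n]*n; n%d<d)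
open import Data.Integer.Properties
  using (abs-*; ∣i∣≡0⇒i≡0; i-j≡0⇒i≡j; i*j≡0⇒i≡0∨j≡0; i^n≡0⇒i≡0; neg-injective;
         ^-*-assoc; ^-distribˡ-+-*)
import Data.Integer.Tactic.RingSolver as ℤ
open import Data.Product using (_,_)
open import Data.Sum using (inj₁; inj₂; [_,_]′)
open import Function using (_∘_)
open import Relation.Nullary using (contradiction)
open import Relation.Binary.PropositionalEquality
  using (refl; sym; trans; cong; cong₂; subst; subst₂; module ≡-Reasoning)
open import Tactic.RingSolver.NonReflective ℤ.ring
  using (Expr; Κ; _⊕_; _⊗_; ⊝_; solve) renaming (_⊜_ to infix 4 _⊜_)

-- The solver's own power _⊛_ does not compute to the power of ℤ.
infixr 8 _↑_
_↑_ : ∀ {n} → Expr ℤ n → ℕ → Expr ℤ n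
e ↑ k = fold (Κ (+ 1)) (e ⊗_) k

infixl 6 _⊖_
_⊖_ : ∀ {n} → Expr ℤ n → Expr ℤ n → Expr ℤ n
e ⊖ f = e ⊕ ⊝ f

-- Exact integer division.

i*j/j≡i : ∀ i j .{{_ : NonZero j}} → (i * j) div j ≡ i
-- The remainder `r` is a multiple of `j` yet smaller than `∣ j ∣`; cancelling `∣ j ∣` leaves
-- `∣ i - q ∣ < 1`.
i*j/j≡i i j = sym (i-j≡0⇒i≡j i q (∣i∣≡0⇒i≡0 (ℕ.n<1⇒n≡0 (ℕ.*-cancelʳ-< ∣ j ∣ _ 1 <1*∣j∣))))
  where
  q = (i * j) div j
  r = (i * j) mod j

  [i-q]*j≡r : (i - q) * j ≡ + r
  [i-q]*j≡r = begin
    (i - q) * j          ≡⟨ solve 3 (λ i j q → (i ⊖ q) ⊗ j ⊜ i ⊗ j ⊖ q ⊗ j) refl i j q ⟩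
    i * j - q * j        ≡⟨ cong (_- q * j) (a≡a%n+[a/n]*n (i * j) j) ⟩
    + r + q * j - q * j  ≡⟨ solve 2 (λ r s → r ⊕ s ⊖ s ⊜ r) refl (+ r) (q * j) ⟩
    + r                  ∎
    where open ≡-Reasoning

  <1*∣j∣ : ∣ i - q ∣ ℕ.* ∣ j ∣ ℕ.< 1 ℕ.* ∣ j ∣
  <1*∣j∣ = subst₂ ℕ._<_ (trans (sym (cong ∣_∣ [i-q]*j≡r)) (abs-* (i - q) j))
                        (sym (ℕ.*-identityˡ ∣ j ∣)) (n%d<d (i * j) j)

divZ-* : ∀ i j → j ≢ + 0 → divZ (i * j) j ≡ i
divZ-* i (+ zero)     j≢0 = contradiction refl j≢0
divZ-* i j@(+[1+ _ ]) _   = i*j/j≡i i j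
divZ-* i j@(-[1+ _ ]) _   = i*j/j≡i i j

-- Nonzero products, squares and cubes.

*-≢0 : ∀ {i j} → i ≢ + 0 → j ≢ + 0 → i * j ≢ + 0
*-≢0 {i} i≢0 j≢0 = [ i≢0 , j≢0 ]′ ∘ i*j≡0⇒i≡0∨j≡0 i

^-≢0 : ∀ {i} n → i ≢ + 0 → i ^ n ≢ + 0
^-≢0 {i} n i≢0 = i≢0 ∘ i^n≡0⇒i≡0 i n

neg-≢0 : ∀ {i} → i ≢ + 0 → - i ≢ + 0
neg-≢0 i≢0 = i≢0 ∘ neg-injective

IsSquare-*² : ∀ {i} w → w ≢ + 0 → IsSquare i → IsSquare (i * (w * w))
IsSquare-*² w w≢0 (β , β≢0 , inj₁ refl) = β * w , *-≢0 β≢0 w≢0 , inj₁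
  (solve 2 (λ β w → β ⊗ β ⊗ (w ⊗ w) ⊜ β ⊗ w ⊗ (β ⊗ w)) refl β w)
IsSquare-*² w w≢0 (β , β≢0 , inj₂ refl) = β * w , *-≢0 β≢0 w≢0 , inj₂
  (solve 2 (λ β w → ⊝ (β ⊗ β) ⊗ (w ⊗ w) ⊜ ⊝ (β ⊗ w ⊗ (β ⊗ w))) refl β w)

IsCube-*³ : ∀ {i} w → w ≢ + 0 → IsCube i → IsCube (i * (w * w * w))
IsCube-*³ w w≢0 (β , β≢0 , refl) = β * w , *-≢0 β≢0 w≢0 ,
  solve 2 (λ β w → β ⊗ β ⊗ β ⊗ (w ⊗ w ⊗ w) ⊜ β ⊗ w ⊗ (β ⊗ w) ⊗ (β ⊗ w)) refl β w

-- The quasi-periodic sequence and its recurrences.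

g : (p q e : ℤ) → ℕ → ℤ
g p q e 0 = + 0
g p q e 1 = + 1
g p q e 2 = p
g p q e 3 = q
g p q e 4 = e * p
g p q e 5 = e * e
-- Quasi-periodicity is built into the definition, so the recurrences become the statements to
-- prove. With `p`, `q`, `e` independent, they are polynomial identities modulo the relation for q³.
g p q e (suc (suc (suc (suc (suc (suc n)))))) = g p q e n * - (e ^ (3 ℕ.+ n))

-- The signs of the two factors cancel, and the exponents 3 + n and 9 + n add up to 2(6 + n).
g-shift₁₂ : ∀ p q e n → let w = e ^ (6 ℕ.+ n) in g p q e (12 ℕ.+ n) ≡ g p q e n * (w * w)
g-shift₁₂ p q e n = solve 3 (λ e u x →
  x ⊗ ⊝ u ⊗ ⊝ (e ⊗ (e ⊗ (e ⊗ (e ⊗ (e ⊗ (e ⊗ u)))))) ⊜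
  x ⊗ (e ⊗ (e ⊗ (e ⊗ u)) ⊗ (e ⊗ (e ⊗ (e ⊗ u))))) refl e (e ^ (3 ℕ.+ n)) (g p q e n)

-- The exponents 3 + n, 9 + n and 15 + n average to the middle one, and three minus signs leave one.
g-shift₁₈ : ∀ p q e n → let w = - (e ^ (9 ℕ.+ n)) in
  g p q e (18 ℕ.+ n) ≡ g p q e n * (w * w * w)
g-shift₁₈ p q e n = begin
  x * - u * - v * - (e ^ (15 ℕ.+ n))   ≡⟨ cong₂ (λ v z → x * - u * - v * - z)
                                            (^-distribˡ-+-* e 6 (3 ℕ.+ n)) (^-distribˡ-+-* e 6 (9 ℕ.+ n)) ⟩
  x * - u * - (e⁶ * u) * - (e⁶ * v)    ≡⟨ cong (λ v → x * - u * - (e⁶ * u) * - (e⁶ * v))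
                                            (^-distribˡ-+-* e 6 (3 ℕ.+ n)) ⟩
  x * - u * - (e⁶ * u) * - (e⁶ * (e⁶ * u))
    ≡⟨ solve 3 (λ k u x → let v = k ⊗ u in
         x ⊗ ⊝ u ⊗ ⊝ v ⊗ ⊝ (k ⊗ v) ⊜ x ⊗ (⊝ v ⊗ ⊝ v ⊗ ⊝ v)) refl e⁶ u x ⟩
  x * (- (e⁶ * u) * - (e⁶ * u) * - (e⁶ * u))
    ≡⟨ cong (λ v → x * (- v * - v * - v)) (sym (^-distribˡ-+-* e 6 (3 ℕ.+ n))) ⟩
  x * (- v * - v * - v)                ∎
  where
  open ≡-Reasoning
  e⁶ u v x : ℤ
  e⁶ = e ^ 6
  u = e ^ (3 ℕ.+ n)
  v = e ^ (9 ℕ.+ n)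
  x = g p q e n

module _ (p q e : ℤ) (q³≡ : q ^ 3 ≡ e * p ^ 4 - e * e) where

  private
    h : ℕ → ℤ
    h = g p q e

  -- The odd recurrence at m = 1 + i. Raising i by 6 raises the left index by 12, hence the
  -- induction in steps of six.
  g-odd : ∀ i → h (3 ℕ.+ i ℕ.* 2) ≡ h (3 ℕ.+ i) * h (1 ℕ.+ i) ^ 3 - h i * h (2 ℕ.+ i) ^ 3
  g-odd 0 = solve 2 (λ p q → q ⊜ q ⊗ Κ (+ 1) ↑ 3 ⊖ Κ (+ 0) ⊗ p ↑ 3) refl p q
  -- The solver knows no hypotheses: ep⁴ - e² stands in for q³ and is exchanged for `q ^ 3`
  -- afterwards.
  g-odd 1 = trans
    (solve 2 (λ p e → e ⊗ e ⊜
      e ⊗ p ⊗ p ↑ 3 ⊖ Κ (+ 1) ⊗ (e ⊗ p ↑ 4 ⊖ e ⊗ e)) refl p e)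
    (cong (λ c → e * p * p ^ 3 - + 1 * c) (sym q³≡))
  g-odd 2 = trans
    (solve 2 (λ p e → Κ (+ 1) ⊗ ⊝ (e ↑ 4) ⊜
      e ⊗ e ⊗ (e ⊗ p ↑ 4 ⊖ e ⊗ e) ⊖ p ⊗ (e ⊗ p) ↑ 3) refl p e)
    (cong (λ c → e * e * c - p * (e * p) ^ 3) (sym q³≡))
  -- The expressions follow the unfolding of `h` literally: `h 6` is `+ 0 * - (e ^ 3)`.
  g-odd 3 = solve 3 (λ p q e → q ⊗ ⊝ (e ↑ 6) ⊜
    Κ (+ 0) ⊗ ⊝ (e ↑ 3) ⊗ (e ⊗ p) ↑ 3 ⊖ q ⊗ (e ⊗ e) ↑ 3) refl p q e
  g-odd 4 = solve 2 (λ p e → e ⊗ e ⊗ ⊝ (e ↑ 8) ⊜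
    Κ (+ 1) ⊗ ⊝ (e ↑ 4) ⊗ (e ⊗ e) ↑ 3
      ⊖ e ⊗ p ⊗ (Κ (+ 0) ⊗ ⊝ (e ↑ 3)) ↑ 3) refl p e
  -- High powers of e are split here and below: the solver's cost explodes with the degree.
  g-odd 5 = trans
    (cong (λ e¹⁰ → + 1 * - (e ^ 4) * - e¹⁰) (^-distribˡ-+-* e 6 4))
    (solve 3 (λ p e e⁴ → let e⁶ = e ⊗ (e ⊗ e⁴) in
      Κ (+ 1) ⊗ ⊝ e⁴ ⊗ ⊝ (e⁶ ⊗ e⁴) ⊜
      p ⊗ ⊝ (e ⊗ e⁴) ⊗ (Κ (+ 0) ⊗ ⊝ (e ↑ 3)) ↑ 3
        ⊖ e ⊗ e ⊗ (Κ (+ 1) ⊗ ⊝ e⁴) ↑ 3) refl p e (e ^ 4))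
  g-odd (suc (suc (suc (suc (suc (suc i)))))) = begin
    -- Both sides gain the factor e^(18 + 4i). Writing e^(9 + 2i) as e(e^(4 + i))² leaves
    -- `e ^ (3 ℕ.+ i)` as the only power the solver must treat as an atom.
    h (15 ℕ.+ i ℕ.* 2)                               ≡⟨ g-shift₁₂ p q e (3 ℕ.+ i ℕ.* 2) ⟩
    h (3 ℕ.+ i ℕ.* 2) * square (e ^ (9 ℕ.+ i ℕ.* 2)) ≡⟨ cong₂ (λ x w → x * square (e * w))
                                                          (g-odd i) (sym (^-*-assoc e (4 ℕ.+ i) 2)) ⟩
    (h (3 ℕ.+ i) * h (1 ℕ.+ i) ^ 3 - h i * h (2 ℕ.+ i) ^ 3) * square (e * (e ^ (4 ℕ.+ i)) ^ 2)
      ≡⟨ solve 6 (λ e u x₀ x₁ x₂ x₃ → let w = e ⊗ (e ⊗ u) ↑ 2 in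
           (x₃ ⊗ x₁ ↑ 3 ⊖ x₀ ⊗ x₂ ↑ 3) ⊗ (w ⊗ w) ⊜
           x₃ ⊗ ⊝ (e ⊗ (e ⊗ (e ⊗ u))) ⊗ (x₁ ⊗ ⊝ (e ⊗ u)) ↑ 3
             ⊖ x₀ ⊗ ⊝ u ⊗ (x₂ ⊗ ⊝ (e ⊗ (e ⊗ u))) ↑ 3) refl
           e (e ^ (3 ℕ.+ i)) (h i) (h (1 ℕ.+ i)) (h (2 ℕ.+ i)) (h (3 ℕ.+ i)) ⟩
    h (9 ℕ.+ i) * h (7 ℕ.+ i) ^ 3 - h (6 ℕ.+ i) * h (8 ℕ.+ i) ^ 3 ∎
    where
    open ≡-Reasoning
    square : ℤ → ℤ
    square w = w * w

  -- The even recurrence at m = 2 + i, multiplied by h₂ to avoid division. Under i ↦ 6 + i both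
  -- sides gain e^(20 + 4i).
  g-even : ∀ i → h (4 ℕ.+ i ℕ.* 2) * p ≡
    h (2 ℕ.+ i) * (h (4 ℕ.+ i) * h (1 ℕ.+ i) ^ 2 - h i * h (3 ℕ.+ i) ^ 2)
  g-even 0 = solve 3 (λ p q e → e ⊗ p ⊗ p ⊜
    p ⊗ (e ⊗ p ⊗ Κ (+ 1) ↑ 2 ⊖ Κ (+ 0) ⊗ q ↑ 2)) refl p q e
  g-even 1 = solve 3 (λ p q e → Κ (+ 0) ⊗ ⊝ (e ↑ 3) ⊗ p ⊜
    q ⊗ (e ⊗ e ⊗ p ↑ 2 ⊖ Κ (+ 1) ⊗ (e ⊗ p) ↑ 2)) refl p q e
  g-even 2 = solve 3 (λ p q e → p ⊗ ⊝ (e ↑ 5) ⊗ p ⊜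
    e ⊗ p ⊗ (Κ (+ 0) ⊗ ⊝ (e ↑ 3) ⊗ q ↑ 2 ⊖ p ⊗ (e ⊗ e) ↑ 2)) refl p q e
  g-even 3 = solve 3 (λ p q e → e ⊗ p ⊗ ⊝ (e ↑ 7) ⊗ p ⊜
    e ⊗ e ⊗ (Κ (+ 1) ⊗ ⊝ (e ↑ 4) ⊗ (e ⊗ p) ↑ 2
      ⊖ q ⊗ (Κ (+ 0) ⊗ ⊝ (e ↑ 3)) ↑ 2)) refl p q e
  g-even 4 = solve 2 (λ p e →
    Κ (+ 0) ⊗ ⊝ (e ↑ 3) ⊗ ⊝ (e ↑ 9) ⊗ p ⊜
    Κ (+ 0) ⊗ ⊝ (e ↑ 3) ⊗ (p ⊗ ⊝ (e ↑ 5) ⊗ (e ⊗ e) ↑ 2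
      ⊖ e ⊗ p ⊗ (Κ (+ 1) ⊗ ⊝ (e ↑ 4)) ↑ 2)) refl p e
  g-even 5 = trans
    (cong (λ e¹¹ → p * - (e ^ 5) * - e¹¹ * p) (^-distribˡ-+-* e 6 5))
    (solve 5 (λ p q e e⁴ e⁵ → let e⁶ = e ⊗ (e ⊗ e⁴) in
      p ⊗ ⊝ e⁵ ⊗ ⊝ (e⁶ ⊗ e⁵) ⊗ p ⊜
      Κ (+ 1) ⊗ ⊝ e⁴ ⊗
        (q ⊗ ⊝ e⁶ ⊗ (Κ (+ 0) ⊗ ⊝ (e ↑ 3)) ↑ 2
          ⊖ e ⊗ e ⊗ (p ⊗ ⊝ e⁵) ↑ 2)) refl p q e (e ^ 4) (e ^ 5))
  g-even (suc (suc (suc (suc (suc (suc i)))))) = begin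
    h (16 ℕ.+ i ℕ.* 2) * p                                ≡⟨ cong (_* p) (g-shift₁₂ p q e (4 ℕ.+ i ℕ.* 2)) ⟩
    h (4 ℕ.+ i ℕ.* 2) * square (e ^ (10 ℕ.+ i ℕ.* 2)) * p ≡⟨ solve 3 (λ x y p → x ⊗ y ⊗ p ⊜ x ⊗ p ⊗ y) refl
                                                               (h (4 ℕ.+ i ℕ.* 2)) (square (e ^ (10 ℕ.+ i ℕ.* 2))) p ⟩
    h (4 ℕ.+ i ℕ.* 2) * p * square (e ^ (10 ℕ.+ i ℕ.* 2)) ≡⟨ cong₂ (λ x w → x * square w)
                                                               (g-even i) (sym (^-*-assoc e (5 ℕ.+ i) 2)) ⟩
    h (2 ℕ.+ i) * (h (4 ℕ.+ i) * h (1 ℕ.+ i) ^ 2 - h i * h (3 ℕ.+ i) ^ 2) * square ((e ^ (5 ℕ.+ i)) ^ 2)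
      ≡⟨ solve 7 (λ e u x₀ x₁ x₂ x₃ x₄ → let w = (e ⊗ (e ⊗ u)) ↑ 2 in
           x₂ ⊗ (x₄ ⊗ x₁ ↑ 2 ⊖ x₀ ⊗ x₃ ↑ 2) ⊗ (w ⊗ w) ⊜
           x₂ ⊗ ⊝ (e ⊗ (e ⊗ u)) ⊗ (x₄ ⊗ ⊝ (e ⊗ (e ⊗ (e ⊗ (e ⊗ u)))) ⊗ (x₁ ⊗ ⊝ (e ⊗ u)) ↑ 2
             ⊖ x₀ ⊗ ⊝ u ⊗ (x₃ ⊗ ⊝ (e ⊗ (e ⊗ (e ⊗ u)))) ↑ 2)) refl
           e (e ^ (3 ℕ.+ i)) (h i) (h (1 ℕ.+ i)) (h (2 ℕ.+ i)) (h (3 ℕ.+ i)) (h (4 ℕ.+ i)) ⟩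
    h (8 ℕ.+ i) * (h (10 ℕ.+ i) * h (7 ℕ.+ i) ^ 2 - h (6 ℕ.+ i) * h (9 ℕ.+ i) ^ 2) ∎
    where
    open ≡-Reasoning
    square : ℤ → ℤ
    square w = w * w

-- Agreement of `hSeq` with `g`.

oddTerm evenNumerator : (ℕ → ℤ) → ℕ → ℤ
oddTerm       f m = f (m ℕ.+ 2) * f m ^ 3 - f (m ℕ.∸ 1) * f (m ℕ.+ 1) ^ 3
evenNumerator f m = f m * (f (m ℕ.+ 2) * f (m ℕ.∸ 1) ^ 2 - f (m ℕ.∸ 2) * f (m ℕ.+ 1) ^ 2)

-- `step` is blocked on its own `with`; abstracting the same remainder together with `eq` releases
-- it.
step-odd : ∀ α f k → (5 ℕ.+ k) % 2 ≡ 1 → step α f (5 ℕ.+ k) ≡ oddTerm f ((5 ℕ.+ k) ℕ./ 2)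
step-odd α f k eq with (5 ℕ.+ k) % 2 | eq
... | _ | refl = refl

step-even : ∀ α f k → (5 ℕ.+ k) % 2 ≡ 0 →
            step α f (5 ℕ.+ k) ≡ divZ (evenNumerator f ((5 ℕ.+ k) ℕ./ 2)) (h₂ α)
step-even α f k eq with (5 ℕ.+ k) % 2 | eq
... | _ | refl = refl

oddTerm-cong : ∀ (f h : ℕ → ℤ) i → (∀ c → c ℕ.≤ 4 → f (c ℕ.+ i) ≡ h (c ℕ.+ i)) →
  oddTerm f (2 ℕ.+ i) ≡ h (4 ℕ.+ i) * h (2 ℕ.+ i) ^ 3 - h (1 ℕ.+ i) * h (3 ℕ.+ i) ^ 3
oddTerm-cong f h i f≡h
  rewrite ℕ.+-comm i 1 | ℕ.+-comm i 2
        | f≡h 1 (ℕ.≤ᵇ⇒≤ 1 4 _) | f≡h 2 (ℕ.≤ᵇ⇒≤ 2 4 _) | f≡h 3 (ℕ.≤ᵇ⇒≤ 3 4 _) | f≡h 4 ℕ.≤-refl = refl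

evenNumerator-cong : ∀ (f h : ℕ → ℤ) i → (∀ c → c ℕ.≤ 5 → f (c ℕ.+ i) ≡ h (c ℕ.+ i)) →
  evenNumerator f (3 ℕ.+ i) ≡
  h (3 ℕ.+ i) * (h (5 ℕ.+ i) * h (2 ℕ.+ i) ^ 2 - h (1 ℕ.+ i) * h (4 ℕ.+ i) ^ 2)
evenNumerator-cong f h i f≡h
  rewrite ℕ.+-comm i 1 | ℕ.+-comm i 2
        | f≡h 1 (ℕ.≤ᵇ⇒≤ 1 5 _) | f≡h 2 (ℕ.≤ᵇ⇒≤ 2 5 _) | f≡h 3 (ℕ.≤ᵇ⇒≤ 3 5 _)
        | f≡h 4 (ℕ.≤ᵇ⇒≤ 4 5 _) | f≡h 5 ℕ.≤-refl = refl

module _ (α p q e : ℤ) (h₂≡p : h₂ α ≡ p) (h₃≡q : h₃ α ≡ q) (h₄≡e*p : h₄ α ≡ e * p)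
         (p≢0 : p ≢ + 0) (q³≡ : q ^ 3 ≡ e * p ^ 4 - e * e) where

  private
    h : ℕ → ℤ
    h = g p q e

  module _ (f : ℕ → ℤ) where

    oddTerm≡g : ∀ n m → 5 ℕ.≤ n → n ≡ 1 ℕ.+ m ℕ.* 2 → (∀ {i} → i ℕ.< n → f i ≡ h i) → oddTerm f m ≡ h n
    oddTerm≡g _ 1 (ℕ.s≤s (ℕ.s≤s (ℕ.s≤s ()))) refl _
    oddTerm≡g _ (suc (suc i)) _ refl f≡h = trans
      -- Here n = 5 + 2i, so c ≤ 4 gives c + i < n: every index read lies below n.
      (oddTerm-cong f h i λ c c≤4 → f≡h (ℕ.+-mono-≤ (ℕ.s≤s c≤4) (ℕ.m≤m*n i 2)))
      (sym (g-odd p q e q³≡ (1 ℕ.+ i)))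

    evenTerm≡g : ∀ n m → 5 ℕ.≤ n → n ≡ m ℕ.* 2 → (∀ {i} → i ℕ.< n → f i ≡ h i) →
                 divZ (evenNumerator f m) (h₂ α) ≡ h n
    evenTerm≡g _ 1 (ℕ.s≤s (ℕ.s≤s ())) refl _
    evenTerm≡g _ 2 (ℕ.s≤s (ℕ.s≤s (ℕ.s≤s (ℕ.s≤s ())))) refl _
    evenTerm≡g _ (suc (suc (suc i))) _ refl f≡h = trans
      (cong₂ divZ
        (trans (evenNumerator-cong f h i λ c c≤5 → f≡h (ℕ.+-mono-≤ (ℕ.s≤s c≤5) (ℕ.m≤m*n i 2)))
               (sym (g-even p q e q³≡ (1 ℕ.+ i))))
        h₂≡p)
      (divZ-* (h (6 ℕ.+ i ℕ.* 2)) p p≢0)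

    step≡g : ∀ n → (∀ {i} → i ℕ.< n → f i ≡ h i) → step α f n ≡ h n
    step≡g 0 _ = refl
    step≡g 1 _ = refl
    step≡g 2 _ = h₂≡p
    step≡g 3 _ = h₃≡q
    step≡g 4 _ = h₄≡e*p
    step≡g n@(suc (suc (suc (suc (suc k))))) f≡h = byParity (n % 2) refl (ℕ.m%n<n n 2)
      where
      5≤n : 5 ℕ.≤ n
      5≤n = ℕ.m≤m+n 5 k

      n≡ : ∀ {r} → n % 2 ≡ r → n ≡ r ℕ.+ (n ℕ./ 2) ℕ.* 2
      n≡ refl = ℕ.m≡m%n+[m/n]*n n 2

      byParity : ∀ r → n % 2 ≡ r → r ℕ.< 2 → step α f n ≡ h n
      byParity 0 eq _ = trans (step-even α f k eq) (evenTerm≡g n (n ℕ./ 2) 5≤n (n≡ eq) f≡h)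
      byParity 1 eq _ = trans (step-odd α f k eq) (oddTerm≡g n (n ℕ./ 2) 5≤n (n≡ eq) f≡h)
      byParity (suc (suc _)) _ (ℕ.s≤s (ℕ.s≤s ()))

  -- Each recursive index is below n, hence below the remaining fuel, so the default `+ 0` of
  -- exhausted fuel is never read.
  go≡g : ∀ fuel {n} → n ℕ.< fuel → go α fuel n ≡ h n
  go≡g (suc fuel) {n} n<1+fuel = step≡g (go α fuel) n
    (λ i<n → go≡g fuel (ℕ.<-≤-trans i<n (ℕ.s≤s⁻¹ n<1+fuel)))

  hSeq≡g : ∀ n → hSeq α n ≡ h n
  hSeq≡g n = go≡g (suc n) ℕ.≤-refl

-- Squares and cubes along residue classes.

module _ (p q e : ℤ) (p≢0 : p ≢ + 0) (e≢0 : e ≢ + 0) (q≡p³ : q ≡ p * p * p) where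

  private
    h : ℕ → ℤ
    h = g p q e

  IsSquare-shift : ∀ s k → IsSquare (h s) → IsSquare (h (s ℕ.+ k ℕ.* 12))
  IsSquare-shift s zero    sq = subst (IsSquare ∘ h) (sym (ℕ.+-identityʳ s)) sq
  IsSquare-shift s (suc k) sq = subst (IsSquare ∘ h) (x∙yz≈y∙xz 12 s (k ℕ.* 12))
    (subst IsSquare (sym (g-shift₁₂ p q e n))
      (IsSquare-*² (e ^ (6 ℕ.+ n)) (^-≢0 (6 ℕ.+ n) e≢0) (IsSquare-shift s k sq)))
    where n = s ℕ.+ k ℕ.* 12

  IsCube-shift : ∀ s k → IsCube (h s) → IsCube (h (s ℕ.+ k ℕ.* 18))
  IsCube-shift s zero    cb = subst (IsCube ∘ h) (sym (ℕ.+-identityʳ s)) cb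
  IsCube-shift s (suc k) cb = subst (IsCube ∘ h) (x∙yz≈y∙xz 18 s (k ℕ.* 18))
    (subst IsCube (sym (g-shift₁₈ p q e n))
      (IsCube-*³ (- (e ^ (9 ℕ.+ n))) (neg-≢0 (^-≢0 (9 ℕ.+ n) e≢0)) (IsCube-shift s k cb)))
    where n = s ℕ.+ k ℕ.* 18

  g₁-IsSquare : IsSquare (h 1)
  g₁-IsSquare = + 1 , (λ ()) , inj₁ refl

  g₅-IsSquare : IsSquare (h 5)
  g₅-IsSquare = e , e≢0 , inj₁ refl

  g₇-IsSquare : IsSquare (h 7)
  -- h₇ = -e⁴, the negative of a square, as the sign convention permits.
  g₇-IsSquare = e ^ 2 , ^-≢0 2 e≢0 , inj₂
    (solve 1 (λ e → Κ (+ 1) ⊗ ⊝ (e ↑ 4) ⊜ ⊝ (e ↑ 2 ⊗ e ↑ 2)) refl e)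

  g₁₁-IsSquare : IsSquare (h 11)
  g₁₁-IsSquare = e ^ 5 , ^-≢0 5 e≢0 , inj₂
    (solve 1 (λ e → e ⊗ e ⊗ ⊝ (e ↑ 8) ⊜ ⊝ (e ↑ 5 ⊗ e ↑ 5)) refl e)

  g₁-IsCube : IsCube (h 1)
  g₁-IsCube = + 1 , (λ ()) , refl

  g₃-IsCube : IsCube (h 3)
  g₃-IsCube = p , p≢0 , q≡p³

  g₉-IsCube : IsCube (h 9)
  g₉-IsCube = - (p * e ^ 2) , neg-≢0 (*-≢0 p≢0 (^-≢0 2 e≢0)) , trans
    (cong (_* - (e ^ 6)) q≡p³)
    (solve 2 (λ p e → let c = ⊝ (p ⊗ e ↑ 2) in p ⊗ p ⊗ p ⊗ ⊝ (e ↑ 6) ⊜ c ⊗ c ⊗ c) refl p e)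

  g₁₅-IsCube : IsCube (h 15)
  -- h₁₅ = p³e⁶e¹², two sign changes having cancelled.
  g₁₅-IsCube = p * e ^ 6 , *-≢0 p≢0 (^-≢0 6 e≢0) , trans
    (cong₂ (λ q e¹² → q * - (e ^ 6) * - e¹²) q≡p³ (^-distribˡ-+-* e 6 6))
    (solve 2 (λ p e⁶ → let c = p ⊗ e⁶ in
      p ⊗ p ⊗ p ⊗ ⊝ e⁶ ⊗ ⊝ (e⁶ ⊗ e⁶) ⊜ c ⊗ c ⊗ c) refl p (e ^ 6))

  g₁₇-IsCube : IsCube (h 17)
  g₁₇-IsCube = e ^ 8 , ^-≢0 8 e≢0 , trans
    (cong (λ e¹⁴ → e * e * - (e ^ 8) * - e¹⁴) (^-distribˡ-+-* e 6 8))
    (solve 2 (λ e e⁶ → let e⁸ = e ⊗ (e ⊗ e⁶) in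
      e ⊗ e ⊗ ⊝ e⁸ ⊗ ⊝ (e⁶ ⊗ e⁸) ⊜ e⁸ ⊗ e⁸ ⊗ e⁸) refl e (e ^ 6))

  g-IsSquare : ∀ n → (n % 12 ≡ 1 ⊎ n % 12 ≡ 5 ⊎ n % 12 ≡ 7 ⊎ n % 12 ≡ 11) → IsSquare (h n)
  g-IsSquare n = [ from g₁-IsSquare , [ from g₅-IsSquare , [ from g₇-IsSquare , from g₁₁-IsSquare ]′ ]′ ]′
    where
    from : ∀ {s} → IsSquare (h s) → n % 12 ≡ s → IsSquare (h n)
    from sq refl = subst (IsSquare ∘ h) (sym (ℕ.m≡m%n+[m/n]*n n 12)) (IsSquare-shift (n % 12) (n ℕ./ 12) sq)

  g-IsCube : ∀ n → (n % 18 ≡ 1 ⊎ n % 18 ≡ 3 ⊎ n % 18 ≡ 9 ⊎ n % 18 ≡ 15 ⊎ n % 18 ≡ 17) → IsCube (h n)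
  g-IsCube n =
    [ from g₁-IsCube , [ from g₃-IsCube , [ from g₉-IsCube , [ from g₁₅-IsCube , from g₁₇-IsCube ]′ ]′ ]′ ]′
    where
    from : ∀ {s} → IsCube (h s) → n % 18 ≡ s → IsCube (h n)
    from cb refl = subst (IsCube ∘ h) (sym (ℕ.m≡m%n+[m/n]*n n 18)) (IsCube-shift (n % 18) (n ℕ./ 18) cb)

-- The initial values in terms of h₂ and α.

h₃≡h₂³ : ∀ α → h₃ α ≡ h₂ α * h₂ α * h₂ α
h₃≡h₂³ α = solve 2 (λ α β →
  ⊝ (α ↑ 3 ⊗ β ↑ 3) ⊜ ⊝ (α ⊗ β) ⊗ ⊝ (α ⊗ β) ⊗ ⊝ (α ⊗ β)) refl α (α + + 1)

h₄≡-αh₂⁵ : ∀ α → h₄ α ≡ - (α * h₂ α ^ 4) * h₂ α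
h₄≡-αh₂⁵ α = solve 2 (λ α β →
  α ↑ 6 ⊗ β ↑ 5 ⊜ ⊝ (α ⊗ (⊝ (α ⊗ β)) ↑ 4) ⊗ ⊝ (α ⊗ β)) refl α (α + + 1)

-- Both sides are p⁹: ep⁴ - e² = -α(α + 1)p⁸, and -α(α + 1) is p itself.
h₃³≡ : ∀ α → let p = h₂ α; e = - (α * p ^ 4) in h₃ α ^ 3 ≡ e * p ^ 4 - e * e
h₃³≡ α = begin
  h₃ α ^ 3           ≡⟨ cong (_^ 3) (h₃≡h₂³ α) ⟩
  (p * p * p) ^ 3    ≡⟨ solve 1 (λ p → (p ⊗ p ⊗ p) ↑ 3 ⊜ p ↑ 4 ⊗ p ↑ 4 ⊗ p) refl p ⟩
  -- Only the lone factor `p` is unfolded; `p ^ 4` stays an atom.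
  p ^ 4 * p ^ 4 * p  ≡⟨ solve 2 (λ α p⁴ → let e = ⊝ (α ⊗ p⁴) in
                          p⁴ ⊗ p⁴ ⊗ ⊝ (α ⊗ (α ⊕ Κ (+ 1))) ⊜ e ⊗ p⁴ ⊖ e ⊗ e) refl α (p ^ 4) ⟩
  e * p ^ 4 - e * e  ∎
  where
  open ≡-Reasoning
  p e : ℤ
  p = h₂ α
  e = - (α * p ^ 4)

theorem5p5 : (α : ℤ) → α ≢ + 0 → α ≢ -[1+ 0 ] →
    ((n : ℕ) → (n % 12 ≡ 1 ⊎ n % 12 ≡ 5 ⊎ n % 12 ≡ 7 ⊎ n % 12 ≡ 11) → IsSquare (hSeq α n))
    × ((n : ℕ) → (n % 18 ≡ 1 ⊎ n % 18 ≡ 3 ⊎ n % 18 ≡ 9 ⊎ n % 18 ≡ 15 ⊎ n % 18 ≡ 17) → IsCube (hSeq α n))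
theorem5p5 α α≢0 α≢-1 =
  (λ n → subst IsSquare (sym (hSeq≡h n)) ∘ g-IsSquare _ _ _ h₂≢0 e≢0 (h₃≡h₂³ α) n) ,
  (λ n → subst IsCube (sym (hSeq≡h n)) ∘ g-IsCube _ _ _ h₂≢0 e≢0 (h₃≡h₂³ α) n)
  where
  e : ℤ
  e = - (α * h₂ α ^ 4)

  α+1≢0 : α + + 1 ≢ + 0
  -- `α + + 1` is `α - -[1+ 0 ]` by computation.
  α+1≢0 = α≢-1 ∘ i-j≡0⇒i≡j α -[1+ 0 ]

  h₂≢0 : h₂ α ≢ + 0
  h₂≢0 = neg-≢0 (*-≢0 α≢0 α+1≢0)

  e≢0 : e ≢ + 0
  e≢0 = neg-≢0 (*-≢0 α≢0 (^-≢0 4 h₂≢0))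

  hSeq≡h : ∀ n → hSeq α n ≡ g (h₂ α) (h₃ α) e n
  hSeq≡h = hSeq≡g α _ _ e refl refl (h₄≡-αh₂⁵ α) h₂≢0 (h₃³≡ α)
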